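{- Consider the two-player pile game with boundary with set of choices $R=\{1,-1\}$ (probability $p$ of $+1$ and $q=1-p$ of $-1$) and target $n\ge1$. Then for every $n$ the winning probability generating functions $W_{n,s_1,s_2}(x)$ of the first player, for all $0\le s_1,s_2\le n$, are rational functions which can all be written with the same denominator, a polynomial of degree at most $n(n+1)$ (with nonzero constant term). Equivalently, the sequence $k\mapsto w_n(k,s_1,s_2)$ is C-finite of order at most $n(n+1)$, and the recurrence relation is the same for all values of $s_1$ and $s_2$ (with different initial values).
   Context: Two-player pile game with boundary, $R=\{1,-1\}$: the first and second player start with $s_1$ and $s_2$ chips, and move alternately, the first player moving first. At his turn a player, independently of everything else, adds one chip to his pile with probability $p$ and removes one chip with probability $q=1-p$, except that if his pile has $0$ chips it stays at $0$ instead of decreasing. The player who first has $n$ chips wins and the game ends. $w_n(k,s_1,s_2)$ is the probability that the first player wins at his own $k$-th turn, and $W_{n,s_1,s_2}(x)=\sum_{k\ge0}w_n(k,s_1,s_2)x^k$. Boundary conventions: $W_{n,n,s_2}(x)=1$ for $0\le s_2\le n$ and $W_{n,s_1,n}(x)=0$ for $0\le s_1<n$. A sequence $a(k)$ is C-finite of order at most $L$ if there are constants $c_1,\dots,c_L$ with $a(k)+c_1a(k-1)+\dots+c_La(k-L)=0$ for all sufficiently large $k$; equivalently, its generating function is a rational function with denominator $1+c_1x+\dots+c_Lx^L$. -}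

module Defs where

open import Level using (Level; _⊔_) renaming (suc to lsuc)
open import Algebra.Bundles using (CommutativeRing)
open import Algebra.Apartness.Bundles using (HeytingField)
import Algebra.Definitions.RawMonoid as RawMonoidDefinitions
open import Data.Fin.Base using (toℕ)
open import Data.List.Base using (List; []; _∷_; _++_; map; foldl; foldr; filter; take; cartesianProduct)
open import Data.Nat.Base as ℕ using (ℕ; zero; suc; pred; _∸_)
open import Data.Nat.Properties using (_≟_; allUpTo?)
open import Data.Product.Base using (_×_; _,_; ∃-syntax)
open import Data.Sign.Base as Sign using (Sign)
open import Data.Sum.Base using (_⊎_)
open import Data.Vec.Functional using (Vector)
open import Relation.Binary.Core using (Rel)
open import Relation.Binary.PropositionalEquality.Core using (_≡_; _≢_)
open import Relation.Binary.Structures using (IsStrictPartialOrder)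
open import Relation.Nullary.Decidable.Core using (Dec; _×-dec_; ¬?)
open import Relation.Nullary.Negation.Core using (¬_)

-- Ordered fields in the constructive sense.  Equality and order need not be
-- decidable, so the real numbers are a model, both classically (with x # y
-- meaning x ≉ y) and constructively.
record OrderedField (c ℓ₁ ℓ₂ ℓ₃ : Level) : Set (lsuc (c ⊔ ℓ₁ ⊔ ℓ₂ ⊔ ℓ₃)) where
  field
    heytingField : HeytingField c ℓ₁ ℓ₂

  open HeytingField heytingField public

  infix 4 _<_ _≤_

  field
    _<_                  : Rel Carrier ℓ₃
    isStrictPartialOrder : IsStrictPartialOrder _≈_ _<_
    #⇒<⊎>                : ∀ {x y} → x # y → x < y ⊎ y < x
    <⇒#                  : ∀ {x y} → x < y → x # y
    +-monoʳ-<            : ∀ x {y z} → y < z → x + y < x + z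
    *-pos                : ∀ {x y} → 0# < x → 0# < y → 0# < x * y

  _≤_ : Rel Carrier ℓ₃
  x ≤ y = ¬ (y < x)

  commutativeRing : CommutativeRing c ℓ₁
  commutativeRing = record { isCommutativeRing = isCommutativeRing }

module PowerSeries {c ℓ : Level} (R : CommutativeRing c ℓ) where

  open CommutativeRing R
  open RawMonoidDefinitions +-rawMonoid using (sum)

  -- The sequence a stands for ∑ₖ a(k) xᵏ.
  Series : Set c
  Series = ℕ → Carrier

  infix  4 _≋_
  infixl 7 _⊛_

  _≋_ : Rel Series ℓ
  f ≋ g = ∀ k → f k ≈ g k

  _⊛_ : Series → Series → Series
  (f ⊛ g) k = sum {suc k} λ i → f (toℕ i) * g (k ∸ toℕ i)

  Degree≤ : ℕ → Series → Set ℓ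
  Degree≤ d f = ∀ {k} → d ℕ.< k → f k ≈ 0#

  IsPolynomial : Series → Set ℓ
  IsPolynomial f = ∃[ d ] Degree≤ d f

  -- f = P / D for some polynomial P; to be used for polynomials D with
  -- nonzero constant term.
  HasDenominator : Series → Series → Set (c ⊔ ℓ)
  HasDenominator f D = ∃[ P ] IsPolynomial P × D ⊛ f ≋ P

  -- a(k) + c₁ a(k-1) + … + c_L a(k-L) = 0 for all sufficiently large k, where
  -- cᵢ₊₁ is the entry of c at index i.
  SatisfiesEventually : {L : ℕ} → Vector Carrier L → (ℕ → Carrier) → Set ℓ
  SatisfiesEventually {L} c a =
    ∃[ K ] (L ℕ.≤ K × (∀ k → K ℕ.≤ k →
      a k + sum (λ i → c i * a (k ∸ suc (toℕ i))) ≈ 0#))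

move : ℕ → Sign → ℕ
move s Sign.+ = suc s
move s Sign.- = pred s  -- pred 0 = 0: an empty pile stays empty

-- The pile of a player with s initial chips after his first i moves, when his
-- successive choices are listed in u.
pile : ℕ → List Sign → ℕ → ℕ
pile s u i = foldl move s (take i u)

-- The first player wins at his own k-th turn: he then has n chips, and neither
-- player had n chips earlier, i.e. after fewer than k moves of his own (the
-- second player has made only k - 1 moves by then).  For k = 0 this says
-- s₁ = n, whatever s₂ is; if s₁ ≠ n and s₂ = n it holds for no k.  So the
-- boundary conventions W = 1 for s₁ = n and W = 0 for s₁ < n, s₂ = n are built in.
FirstWins : (n k s₁ s₂ : ℕ) → List Sign × List Sign → Set
FirstWins n k s₁ s₂ (u , v) =
  pile s₁ u k ≡ n × (∀ {i} → i ℕ.< k → pile s₁ u i ≢ n × pile s₂ v i ≢ n)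

firstWins? : ∀ n k s₁ s₂ uv → Dec (FirstWins n k s₁ s₂ uv)
firstWins? n k s₁ s₂ (u , v) =
  (pile s₁ u k ≟ n) ×-dec
  allUpTo? (λ i → ¬? (pile s₁ u i ≟ n) ×-dec ¬? (pile s₂ v i ≟ n)) k

words : ℕ → List (List Sign)
words zero    = [] ∷ []
words (suc m) = map (Sign.+ ∷_) (words m) ++ map (Sign.- ∷_) (words m)

module Probability {c ℓ : Level} (R : CommutativeRing c ℓ)
                   (p : CommutativeRing.Carrier R) where

  open CommutativeRing R

  q : Carrier
  q = 1# - p

  chance : Sign → Carrier
  chance Sign.+ = p
  chance Sign.- = q

  weight : List Sign → Carrier
  weight = foldr (λ r x → chance r * x) 1#

  -- The probability that the first player wins at his own k-th turn.  By then
  -- he has made k independent choices and his opponent k ∸ 1.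
  w : (n k s₁ s₂ : ℕ) → Carrier
  w n k s₁ s₂ =
    foldr (λ (u , v) x → weight u * weight v + x) 0#
      (filter (firstWins? n k s₁ s₂) (cartesianProduct (words k) (words (k ∸ 1))))

  W : (n s₁ s₂ : ℕ) → PowerSeries.Series R
  W n s₁ s₂ k = w n k s₁ s₂

{-# OPTIONS --safe #-}
module Submission where

-- From turn 2 on, conditioning on the first move of each player gives
--   w(k + 2, s₁, s₂) = ∑ chance(r₁) chance(r₂) w(k + 1, move s₁ r₁, move s₂ r₂),
-- and the terms with a pile of n chips vanish.  So the n² generating functions
-- with s₁, s₂ < n solve a linear system (I - x M) W = b over the power series,
-- with b of degree at most 1.  By Cramer's rule det (I - x M), of degree at most
-- n² and with constant term 1, is a common denominator.

open import Defs
open import Level using (Level)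
open import Algebra.Bundles using (CommutativeRing)
import Algebra.Construct.Pointwise as Pointwise
import Algebra.Properties.CommutativeMonoid.Sum as Sums
import Algebra.Properties.CommutativeSemigroup as CommutativeSemigroupProperties
import Algebra.Properties.Ring as RingProperties
import Algebra.Properties.Semiring.Sum as SemiringSums
open import Data.Fin.Base as Fin using (Fin; zero; suc; inject₁; punchIn; punchOut; toℕ)
open import Data.Fin.Induction using (<-weakInduction)
import Data.Fin.Properties as Fin
open import Data.Bool.Base using (if_then_else_; true; false)
open import Data.List.Base using (List; []; _∷_; _++_; map; foldr; filter; cartesianProduct)
open import Data.Nat.Base as ℕ using (ℕ; zero; suc; s≤s; z≤n; s<s)
import Data.Nat.Properties as ℕ
open import Data.Product.Base using (_×_; _,_; proj₁; proj₂; Σ-syntax; ∃-syntax)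
open import Data.Sign.Base as Sign using (Sign)
open import Data.Sum.Base using (inj₁; inj₂)
open import Data.Vec.Functional using (Vector; tail; removeAt; updateAt)
open import Data.Vec.Functional.Properties using (updateAt-updates; updateAt-minimal)
open import Function.Base using (_∘_; const)
open import Function.Bundles using (_⇔_; mk⇔)
open import Relation.Unary using (Pred; Decidable)
open import Relation.Binary.PropositionalEquality as ≡ using (_≡_; _≢_)
open import Relation.Binary.Definitions using (tri<; tri≈; tri>)
open import Relation.Nullary.Decidable using (yes; no; does; does-⇔; dec-false)
open import Relation.Nullary.Negation using (¬_; contradiction)
import Relation.Binary.Reasoning.Setoid as SetoidReasoning

-- Two things force the recurrence to start at turn 2. At turn 1 the opponent has made no move to
-- condition on, and the boundary values vanish at positive turns only: at turn 0 the value for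
-- `s₁ = n` is 1. The first two coefficients of each series therefore stay unconstrained, and they
-- are what `b` records. Cramer's rule is used in its division-free form, which makes sense over the
-- ring of power series. It rests on row linearity and on vanishing for two equal rows, over an
-- arbitrary commutative ring. Since 2 need not be cancellable there, vanishing for adjacent equal
-- rows comes from the expansion itself, and antisymmetry is derived from it rather than the other
-- way round. That the constant term is exactly 1 does double duty: it shows the denominator to be
-- apart from 0 there without deciding equality, and it lets the other coefficients serve directly
-- as those of the recurrence.

-- Deleting an index near two adjacent indices

punchIn-inject₁-suc : ∀ {n} (c l : Fin n) → l ≢ c →
                      punchIn (inject₁ c) l ≡ punchIn (suc c) l
punchIn-inject₁-suc zero    zero    l≢c = contradiction ≡.refl l≢c
punchIn-inject₁-suc zero    (suc l) l≢c = ≡.refl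
punchIn-inject₁-suc (suc c) zero    l≢c = ≡.refl
punchIn-inject₁-suc (suc c) (suc l) l≢c =
  ≡.cong suc (punchIn-inject₁-suc c l (l≢c ∘ ≡.cong suc))

punchIn-inject₁-self : ∀ {n} (c : Fin n) → punchIn (inject₁ c) c ≡ suc c
punchIn-inject₁-self zero    = ≡.refl
punchIn-inject₁-self (suc c) = ≡.cong suc (punchIn-inject₁-self c)

punchIn-suc-self : ∀ {n} (c : Fin n) → punchIn (suc c) c ≡ inject₁ c
punchIn-suc-self zero    = ≡.refl
punchIn-suc-self (suc c) = ≡.cong suc (punchIn-suc-self c)

-- Adjacent rows remain adjacent when some other row is deleted, which is what the induction in
-- `det-adjacent` needs of the minors.
adjacent-punchIn : ∀ {n} (j : Fin (2 ℕ.+ n)) (c : Fin (suc n)) →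
  j ≢ inject₁ c → j ≢ suc c →
  ∃[ c′ ] punchIn j (inject₁ c′) ≡ inject₁ c × punchIn j (suc c′) ≡ suc c
adjacent-punchIn zero    zero    j≢c j≢sc = contradiction ≡.refl j≢c
adjacent-punchIn zero    (suc c) j≢c j≢sc = c , ≡.refl , ≡.refl
adjacent-punchIn (suc zero) zero j≢c j≢sc = contradiction ≡.refl j≢sc
adjacent-punchIn {suc n} (suc (suc j)) zero j≢c j≢sc = zero , ≡.refl , ≡.refl
adjacent-punchIn {suc n} (suc j) (suc c) j≢c j≢sc =
  let c′ , eq , eq′ = adjacent-punchIn j c (j≢c ∘ ≡.cong suc) (j≢sc ∘ ≡.cong suc)
  in suc c′ , ≡.cong suc eq , ≡.cong suc eq′

inject₁≢suc : ∀ {n} {c : Fin n} → inject₁ c ≢ suc c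
inject₁≢suc {c = zero}  ()
inject₁≢suc {c = suc c} eq = inject₁≢suc (Fin.suc-injective eq)

-- Determinants and Cramer's rule over a commutative ring

module Determinant {c ℓ : Level} (R : CommutativeRing c ℓ) where

  open CommutativeRing R hiding (zero)
  open RingProperties ring
  open Sums +-commutativeMonoid
  open SemiringSums semiring using (*-distribˡ-sum)
  open CommutativeSemigroupProperties +-commutativeSemigroup using () renaming (interchange to +-interchange)
  open CommutativeSemigroupProperties *-commutativeSemigroup using (x∙yz≈y∙xz)
  open SetoidReasoning setoid

  sum-single : ∀ {n} (i : Fin n) {t : Vector Carrier n} →
               (∀ j → j ≢ i → t j ≈ 0#) → sum t ≈ t i
  sum-single {suc n} i {t} t≈0 = begin
    sum t                           ≈⟨ sum-remove {i = i} t ⟩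
    t i + sum (removeAt t i)        ≈⟨ +-congˡ (sum-cong-≋ λ j → t≈0 _ (Fin.punchInᵢ≢i i j)) ⟩
    t i + sum {n} (λ _ → 0#)        ≈⟨ +-congˡ (sum-replicate-zero n) ⟩
    t i + 0#                        ≈⟨ +-identityʳ _ ⟩
    t i                             ∎

  -- The nested subtraction produces the signs of the Laplace expansion without powers of -1 or
  -- parities.
  altsum : ∀ {n} → Vector Carrier n → Carrier
  altsum {zero}  t = 0#
  altsum {suc n} t = t zero - altsum (tail t)

  altsum-cong : ∀ {n} {s t : Vector Carrier n} → (∀ i → s i ≈ t i) → altsum s ≈ altsum t
  altsum-cong {zero}  s≈t = refl
  altsum-cong {suc n} s≈t = +-cong (s≈t zero) (-‿cong (altsum-cong (s≈t ∘ suc)))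

  altsum-linear : ∀ {n} x (s t : Vector Carrier n) →
                  altsum (λ i → x * s i + t i) ≈ x * altsum s + altsum t
  altsum-linear {zero}  x s t = sym (trans (+-identityʳ _) (zeroʳ x))
  altsum-linear {suc n} x s t = begin
    (x * s zero + t zero) - altsum (λ i → x * s (suc i) + t (suc i))
      ≈⟨ +-congˡ (-‿cong (altsum-linear x (tail s) (tail t))) ⟩
    (x * s zero + t zero) - (x * S + T)
      ≈⟨ +-congˡ (-‿+-comm _ _) ⟨
    (x * s zero + t zero) + (- (x * S) - T)
      ≈⟨ +-interchange _ _ _ _ ⟩
    (x * s zero - x * S) + (t zero - T)
      ≈⟨ +-congʳ (+-congˡ (-‿distribʳ-* x S)) ⟩
    (x * s zero + x * - S) + (t zero - T)
      ≈⟨ +-congʳ (distribˡ x _ _) ⟨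
    x * (s zero - S) + (t zero - T) ∎
    where
    S = altsum (tail s)
    T = altsum (tail t)

  altsum-zero : ∀ {n} {t : Vector Carrier n} → (∀ i → t i ≈ 0#) → altsum t ≈ 0#
  altsum-zero {zero}  t≈0 = refl
  altsum-zero {suc n} t≈0 =
    trans (+-cong (t≈0 zero) (-‿cong (altsum-zero (t≈0 ∘ suc)))) (-‿inverseʳ 0#)

  -- Adjacent positions carry opposite signs, so the two terms that are left cancel.
  altsum-adjacent : ∀ {n} (c : Fin n) {t : Vector Carrier (suc n)} →
    t (inject₁ c) ≈ t (suc c) → (∀ j → j ≢ inject₁ c → j ≢ suc c → t j ≈ 0#) →
    altsum t ≈ 0#
  altsum-adjacent zero {t} eq t≈0 = begin
    t zero - (t (suc zero) - altsum (tail (tail t)))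
      ≈⟨ +-cong eq (-‿cong (+-congˡ (-‿cong (altsum-zero λ i → t≈0 (suc (suc i)) (λ ()) (λ ()))))) ⟩
    t (suc zero) - (t (suc zero) - 0#)
      ≈⟨ +-congˡ (-‿cong (trans (+-congˡ -0#≈0#) (+-identityʳ _))) ⟩
    t (suc zero) - t (suc zero)
      ≈⟨ -‿inverseʳ _ ⟩
    0# ∎
  altsum-adjacent (suc c) eq t≈0 =
    trans (+-cong (t≈0 zero (λ ()) (λ ()))
                  (-‿cong (altsum-adjacent c eq λ j j≢c j≢sc →
                    t≈0 (suc j) (j≢c ∘ Fin.suc-injective) (j≢sc ∘ Fin.suc-injective))))
          (-‿inverseʳ 0#)

  Matrix : ℕ → Set c
  Matrix n = Vector (Vector Carrier n) n

  minor : ∀ {n} → Matrix (suc n) → Fin (suc n) → Matrix n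
  minor A j i = tail (removeAt A j i)

  -- Laplace expansion along the first column: each term deletes one row, so properties of rows pass
  -- to the minors by induction.
  det : ∀ {n} → Matrix n → Carrier
  det {zero}  A = 1#
  det {suc n} A = altsum λ j → A j zero * det (minor A j)

  det-cong : ∀ {n} {A B : Matrix n} → (∀ i k → A i k ≈ B i k) → det A ≈ det B
  det-cong {zero}  A≈B = refl
  det-cong {suc n} A≈B = altsum-cong λ j →
    *-cong (A≈B j zero) (det-cong λ i k → A≈B (punchIn j i) (suc k))

  punchIn-punchOut-≢ : ∀ {n} {j c : Fin (suc n)} (j≢c : j ≢ c) {i} →
                       i ≢ punchOut j≢c → punchIn j i ≢ c
  punchIn-punchOut-≢ {j = j} j≢c i≢ eq =
    i≢ (Fin.punchIn-injective j _ _ (≡.trans eq (≡.sym (Fin.punchIn-punchOut j≢c))))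

  -- Row `r` enters each term of the expansion once: through the entry `A r zero` in the term that
  -- deletes it, and through the minor, where induction applies, in all others.
  det-linear : ∀ {n} (r : Fin n) x {A B C : Matrix n} →
    (∀ i → i ≢ r → ∀ k → A i k ≈ B i k) → (∀ i → i ≢ r → ∀ k → A i k ≈ C i k) →
    (∀ k → A r k ≈ x * B r k + C r k) → det A ≈ x * det B + det C
  det-linear {suc n} r x {A} {B} {C} A≈B A≈C Aᵣ = trans (altsum-cong term)
    (altsum-linear x (λ j → B j zero * det (minor B j)) (λ j → C j zero * det (minor C j)))
    where
    term : ∀ j → A j zero * det (minor A j) ≈
                 x * (B j zero * det (minor B j)) + C j zero * det (minor C j)
    term j with j Fin.≟ r
    ... | yes ≡.refl = begin
      A j zero * det (minor A j)
        ≈⟨ *-congʳ (Aᵣ zero) ⟩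
      (x * B j zero + C j zero) * det (minor A j)
        ≈⟨ distribʳ _ _ _ ⟩
      x * B j zero * det (minor A j) + C j zero * det (minor A j)
        ≈⟨ +-cong (*-congˡ (det-cong λ i k → A≈B _ (Fin.punchInᵢ≢i j i) (suc k)))
                  (*-congˡ (det-cong λ i k → A≈C _ (Fin.punchInᵢ≢i j i) (suc k))) ⟩
      x * B j zero * det (minor B j) + C j zero * det (minor C j)
        ≈⟨ +-congʳ (*-assoc _ _ _) ⟩
      x * (B j zero * det (minor B j)) + C j zero * det (minor C j) ∎
    ... | no j≢r = begin
      A j zero * det (minor A j)
        ≈⟨ *-congˡ (det-linear (punchOut j≢r) x
             (λ i i≢ k → A≈B _ (punchIn-punchOut-≢ j≢r i≢) (suc k))
             (λ i i≢ k → A≈C _ (punchIn-punchOut-≢ j≢r i≢) (suc k))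
             minorᵣ) ⟩
      A j zero * (x * det (minor B j) + det (minor C j))
        ≈⟨ distribˡ _ _ _ ⟩
      A j zero * (x * det (minor B j)) + A j zero * det (minor C j)
        ≈⟨ +-cong (trans (x∙yz≈y∙xz _ _ _) (*-congˡ (*-congʳ (A≈B j j≢r zero))))
                  (*-congʳ (A≈C j j≢r zero)) ⟩
      x * (B j zero * det (minor B j)) + C j zero * det (minor C j) ∎
      where
      minorᵣ : ∀ k → minor A j (punchOut j≢r) k ≈
                     x * minor B j (punchOut j≢r) k + minor C j (punchOut j≢r) k
      minorᵣ k rewrite Fin.punchIn-punchOut j≢r = Aᵣ (suc k)

  infixl 8 _[_]≔_

  _[_]≔_ : ∀ {n} → Matrix n → Fin n → Vector Carrier n → Matrix n
  A [ r ]≔ v = updateAt A r (const v)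

  ≔-self : ∀ {n} (A : Matrix n) r v k → (A [ r ]≔ v) r k ≈ v k
  ≔-self A r v k = reflexive (≡.cong-app (updateAt-updates r A) k)

  ≔-other : ∀ {n} (A : Matrix n) r v {i} → i ≢ r → ∀ k → (A [ r ]≔ v) i k ≈ A i k
  ≔-other A r v {i} i≢r k = reflexive (≡.cong-app (updateAt-minimal i r A i≢r) k)

  ≔-id : ∀ {n} (A : Matrix n) r i k → (A [ r ]≔ A r) i k ≈ A i k
  ≔-id A r i k with i Fin.≟ r
  ... | yes ≡.refl = ≔-self A r _ k
  ... | no i≢r     = ≔-other A r _ i≢r k

  det-≔-linear : ∀ {n} (A : Matrix n) r x u v →
    det (A [ r ]≔ (λ k → x * u k + v k)) ≈ x * det (A [ r ]≔ u) + det (A [ r ]≔ v)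
  det-≔-linear A r x u v = det-linear r x (other u) (other v) λ k →
    trans (≔-self A r _ k) (sym (+-cong (*-congˡ (≔-self A r u k)) (≔-self A r v k)))
    where
    other : ∀ w i → i ≢ r → ∀ k → (A [ r ]≔ _) i k ≈ (A [ r ]≔ w) i k
    other w i i≢r k = trans (≔-other A r _ i≢r k) (sym (≔-other A r w i≢r k))

  det-≔-cong : ∀ {n} (A : Matrix n) r {u v} → (∀ k → u k ≈ v k) →
               det (A [ r ]≔ u) ≈ det (A [ r ]≔ v)
  det-≔-cong A r {u} {v} u≈v = det-cong helper
    where
    helper : ∀ i k → (A [ r ]≔ u) i k ≈ (A [ r ]≔ v) i k
    helper i k with i Fin.≟ r
    ... | yes ≡.refl = trans (≔-self A r u k) (trans (u≈v k) (sym (≔-self A r v k)))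
    ... | no i≢r     = trans (≔-other A r u i≢r k) (sym (≔-other A r v i≢r k))

  ≔-congˡ : ∀ {n} (A B : Matrix n) r v i → (∀ k → A i k ≈ B i k) →
            ∀ k → (A [ r ]≔ v) i k ≈ (B [ r ]≔ v) i k
  ≔-congˡ A B r v i A≈B k with i Fin.≟ r
  ... | yes ≡.refl = trans (≔-self A r v k) (sym (≔-self B r v k))
  ... | no i≢r     = trans (≔-other A r v i≢r k) (trans (A≈B k) (sym (≔-other B r v i≢r k)))

  det-≔-zero : ∀ {n} (A : Matrix n) r → det (A [ r ]≔ (λ _ → 0#)) ≈ 0#
  det-≔-zero A r = begin
    -- The zero row is -1 times itself plus itself, so linearity gives `d ≈ - d + d`.
    d              ≈⟨ det-≔-cong A r (λ _ → sym (trans (+-identityʳ _) (zeroʳ _))) ⟩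
    det (A [ r ]≔ (λ _ → - 1# * 0# + 0#))
                   ≈⟨ det-≔-linear A r (- 1#) _ _ ⟩
    - 1# * d + d   ≈⟨ +-congʳ (-1*x≈-x d) ⟩
    - d + d        ≈⟨ -‿inverseˡ d ⟩
    0#             ∎
    where d = det (A [ r ]≔ (λ _ → 0#))

  det-≔-sum : ∀ {m n} (A : Matrix n) r (x : Vector Carrier m) (u : Vector (Vector Carrier n) m) →
    det (A [ r ]≔ (λ k → sum λ l → x l * u l k)) ≈ sum λ l → x l * det (A [ r ]≔ u l)
  det-≔-sum {zero}  A r x u = det-≔-zero A r
  det-≔-sum {suc m} A r x u =
    trans (det-≔-linear A r (x zero) (u zero) _) (+-congˡ (det-≔-sum A r (tail x) (tail u)))

  -- A minor that keeps both rows vanishes by induction; the other two terms are equal and have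
  -- opposite signs. Antisymmetry would only give `d + d ≈ 0`, which does not imply `d ≈ 0` in a
  -- general ring.
  det-adjacent : ∀ {n} (c : Fin n) (A : Matrix (suc n)) →
                 (∀ k → A (inject₁ c) k ≈ A (suc c) k) → det A ≈ 0#
  det-adjacent {suc n} c A eq =
    altsum-adjacent c (*-cong (eq zero) (det-cong same)) others
    where
    same : ∀ i k → minor A (inject₁ c) i k ≈ minor A (suc c) i k
    same i k with i Fin.≟ c
    -- At position `c` each of the two minors holds the row that the other one has deleted; these
    -- rows are equal by assumption. Elsewhere the minors share their rows.
    ... | yes ≡.refl rewrite punchIn-inject₁-self c | punchIn-suc-self c = sym (eq (suc k))
    ... | no i≢c     rewrite punchIn-inject₁-suc c i i≢c = refl
    others : ∀ j → j ≢ inject₁ c → j ≢ suc c → A j zero * det (minor A j) ≈ 0#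
    others j j≢c j≢sc with adjacent-punchIn j c j≢c j≢sc
    ... | c′ , p , p′ = trans (*-congˡ (det-adjacent c′ (minor A j) eq′)) (zeroʳ _)
      where
      eq′ : ∀ k → minor A j (inject₁ c′) k ≈ minor A j (suc c′) k
      eq′ k rewrite p | p′ = eq (suc k)

  -- Expand the determinant with both rows replaced by u + v, which vanishes.
  det-swap : ∀ {n} (c : Fin n) (A : Matrix (suc n)) u v →
    det (A [ inject₁ c ]≔ u [ suc c ]≔ v) + det (A [ inject₁ c ]≔ v [ suc c ]≔ u) ≈ 0#
  det-swap c A u v = begin
    D u v + D v u
      ≈⟨ +-cong (sym (trans (first v) (trans (+-congˡ (twice v)) (trans (+-identityʳ _) (*-identityˡ _)))))
                (sym (trans (first u) (trans (+-congʳ (trans (*-congˡ (twice u)) (zeroʳ _))) (+-identityˡ _)))) ⟩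
    D w v + D w u
      ≈⟨ +-comm _ _ ⟩
    D w u + D w v
      ≈⟨ +-congʳ (*-identityˡ _) ⟨
    1# * D w u + D w v
      ≈⟨ det-≔-linear (A [ inject₁ c ]≔ w) (suc c) 1# u v ⟨
    D w w
      ≈⟨ twice w ⟩
    0# ∎
    where
    D : Vector Carrier _ → Vector Carrier _ → Carrier
    D y z = det (A [ inject₁ c ]≔ y [ suc c ]≔ z)
    w : Vector Carrier _
    w k = 1# * u k + v k
    row-inject₁ : ∀ y z k → (A [ inject₁ c ]≔ y [ suc c ]≔ z) (inject₁ c) k ≈ y k
    row-inject₁ y z k =
      trans (≔-other (A [ inject₁ c ]≔ y) (suc c) z inject₁≢suc k) (≔-self A (inject₁ c) y k)
    twice : ∀ z → D z z ≈ 0#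
    twice z = det-adjacent c (A [ inject₁ c ]≔ z [ suc c ]≔ z) λ k →
      trans (row-inject₁ z z k) (sym (≔-self (A [ inject₁ c ]≔ z) (suc c) z k))
    first : ∀ z → D w z ≈ 1# * D u z + D v z
    first z = det-linear (inject₁ c) 1# (other u) (other v) λ k →
      trans (row-inject₁ w z k) (sym (+-cong (*-congˡ (row-inject₁ u z k)) (row-inject₁ v z k)))
      where
      other : ∀ y i → i ≢ inject₁ c → ∀ k →
              (A [ inject₁ c ]≔ w [ suc c ]≔ z) i k ≈ (A [ inject₁ c ]≔ y [ suc c ]≔ z) i k
      other y i i≢c k = ≔-congˡ (A [ inject₁ c ]≔ w) (A [ inject₁ c ]≔ y) (suc c) z i
        (λ l → trans (≔-other A _ w i≢c l) (sym (≔-other A _ y i≢c l))) k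

  -- Induction on the larger index `s`: exchanging row `s` with its predecessor brings the copy of
  -- row `r` one step closer. The exchanged determinant vanishes by induction, and by `det-swap` it
  -- adds up to 0 with the original.
  det-equal-rows-< : ∀ {n} (s r : Fin (suc n)) → r Fin.< s → (A : Matrix (suc n)) →
                     (∀ k → A r k ≈ A s k) → det A ≈ 0#
  det-equal-rows-< {n} = <-weakInduction Vanishes (λ _ ()) step
    where
    Vanishes : Fin (suc n) → Set _
    Vanishes s = ∀ r → r Fin.< s → (A : Matrix (suc n)) → (∀ k → A r k ≈ A s k) → det A ≈ 0#
    step : ∀ i → Vanishes (inject₁ i) → Vanishes (suc i)
    step i vanishes r r<si A Aᵣ≈Aₛ with r Fin.≟ inject₁ i
    ... | yes ≡.refl = det-adjacent i A Aᵣ≈Aₛ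
    ... | no r≢i     = begin
      det A
        ≈⟨ det-cong unswapped ⟨
      det (A [ inject₁ i ]≔ A (inject₁ i) [ suc i ]≔ A (suc i))
        ≈⟨ trans (+-congˡ (vanishes r r<i _ equal)) (+-identityʳ _) ⟨
      det (A [ inject₁ i ]≔ A (inject₁ i) [ suc i ]≔ A (suc i)) + det B
        ≈⟨ det-swap i A _ _ ⟩
      0# ∎
      where
      B = A [ inject₁ i ]≔ A (suc i) [ suc i ]≔ A (inject₁ i)
      r<i : r Fin.< inject₁ i
      r<i = Fin.≤∧≢⇒< (≡.subst (toℕ r ℕ.≤_) (≡.sym (Fin.toℕ-inject₁ i)) (ℕ.s≤s⁻¹ r<si)) r≢i
      unswapped : ∀ j k → (A [ inject₁ i ]≔ A (inject₁ i) [ suc i ]≔ A (suc i)) j k ≈ A j k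
      unswapped j k = trans
        (≔-congˡ (A [ inject₁ i ]≔ A (inject₁ i)) A (suc i) (A (suc i)) j (≔-id A (inject₁ i) j) k)
        (≔-id A (suc i) j k)
      equal : ∀ k → B r k ≈ B (inject₁ i) k
      equal k = begin
        B r k                                    ≈⟨ ≔-other (A [ inject₁ i ]≔ A (suc i)) (suc i) _ (Fin.<⇒≢ r<si) k ⟩
        (A [ inject₁ i ]≔ A (suc i)) r k         ≈⟨ ≔-other A _ _ r≢i k ⟩
        A r k                                    ≈⟨ Aᵣ≈Aₛ k ⟩
        A (suc i) k                              ≈⟨ ≔-self A (inject₁ i) _ k ⟨
        (A [ inject₁ i ]≔ A (suc i)) (inject₁ i) k ≈⟨ ≔-other (A [ inject₁ i ]≔ A (suc i)) (suc i) _ inject₁≢suc k ⟨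
        B (inject₁ i) k ∎

  det-equal-rows : ∀ {n} {r s : Fin n} → r ≢ s → (A : Matrix n) →
                   (∀ k → A r k ≈ A s k) → det A ≈ 0#
  det-equal-rows {suc n} {r} {s} r≢s A eq with Fin.<-cmp r s
  ... | tri< r<s _ _ = det-equal-rows-< s r r<s A eq
  ... | tri≈ _ r≡s _ = contradiction r≡s r≢s
  ... | tri> _ _ s<r = det-equal-rows-< r s s<r A (sym ∘ eq)

  -- Linearity in row `j` turns the right side into a sum of `x l * det (A [ j ]≔ A l)`, where every
  -- `l` other than `j` gives a matrix with two equal rows.
  cramer : ∀ {n} (A : Matrix n) (x : Vector Carrier n) (j : Fin n) →
    x j * det A ≈ det (A [ j ]≔ (λ k → sum λ l → x l * A l k))
  cramer A x j = begin
    x j * det A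
      ≈⟨ *-congˡ (det-cong (≔-id A j)) ⟨
    x j * det (A [ j ]≔ A j)
      ≈⟨ sum-single j others ⟨
    sum (λ l → x l * det (A [ j ]≔ A l))
      ≈⟨ det-≔-sum A j x A ⟨
    det (A [ j ]≔ (λ k → sum λ l → x l * A l k)) ∎
    where
    others : ∀ l → l ≢ j → x l * det (A [ j ]≔ A l) ≈ 0#
    others l l≢j = trans (*-congˡ (det-equal-rows l≢j (A [ j ]≔ A l) λ k →
      trans (≔-other A j _ l≢j k) (sym (≔-self A j _ k)))) (zeroʳ _)

-- The commutative ring of formal power series

module PowerSeriesRing {c ℓ : Level} (R : CommutativeRing c ℓ) where

  open CommutativeRing R hiding (zero)
  open PowerSeries R
  open Sums +-commutativeMonoid
  open SemiringSums semiring using (*-distribˡ-sum)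
  open RingProperties ring using (-0#≈0#)
  open SetoidReasoning setoid

  sum-zero : ∀ {n} {t : Vector Carrier n} → (∀ i → t i ≈ 0#) → sum t ≈ 0#
  sum-zero {n} t≈0 = trans (sum-cong-≋ t≈0) (sum-replicate-zero n)

  infixl 6 _⊞_

  _⊞_ : Series → Series → Series
  (f ⊞ g) k = f k + g k

  one : Series
  one zero    = 1#
  one (suc k) = 0#

  ⊛-cong : ∀ {f f′ g g′} → f ≋ f′ → g ≋ g′ → f ⊛ g ≋ f′ ⊛ g′
  ⊛-cong f≋f′ g≋g′ k = sum-cong-≋ {suc k} λ i → *-cong (f≋f′ (toℕ i)) (g≋g′ (k ℕ.∸ toℕ i))

  ⊛-distribˡ-⊞ : ∀ f g h → f ⊛ (g ⊞ h) ≋ f ⊛ g ⊞ f ⊛ h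
  ⊛-distribˡ-⊞ f g h k =
    trans (sum-cong-≋ {suc k} λ i → distribˡ (f (toℕ i)) (g (k ℕ.∸ toℕ i)) (h (k ℕ.∸ toℕ i)))
          (∑-distrib-+ {suc k} (λ i → f (toℕ i) * g (k ℕ.∸ toℕ i)) (λ i → f (toℕ i) * h (k ℕ.∸ toℕ i)))

  -- By definition a product unfolds at its first term. Splitting off the last term as well is what
  -- makes the induction in `⊛-comm` close.
  ⊛-sucʳ : ∀ f g k → (f ⊛ g) (suc k) ≈ (f ⊛ (g ∘ suc)) k + f (suc k) * g 0
  ⊛-sucʳ f g zero    = trans (+-congˡ (+-identityʳ _)) (+-congʳ (sym (+-identityʳ _)))
  ⊛-sucʳ f g (suc k) = trans (+-congˡ (⊛-sucʳ (f ∘ suc) g k)) (sym (+-assoc _ _ _))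

  ⊛-comm : ∀ f g → f ⊛ g ≋ g ⊛ f
  ⊛-comm f g zero    = +-congʳ (*-comm _ _)
  ⊛-comm f g (suc k) = begin
    f 0 * g (suc k) + ((f ∘ suc) ⊛ g) k   ≈⟨ +-cong (*-comm _ _) (⊛-comm (f ∘ suc) g k) ⟩
    g (suc k) * f 0 + (g ⊛ (f ∘ suc)) k   ≈⟨ +-comm _ _ ⟩
    (g ⊛ (f ∘ suc)) k + g (suc k) * f 0   ≈⟨ ⊛-sucʳ g f k ⟨
    (g ⊛ f) (suc k)                       ∎

  ⊛-distribʳ-⊞ : ∀ f g h → (g ⊞ h) ⊛ f ≋ g ⊛ f ⊞ h ⊛ f
  ⊛-distribʳ-⊞ f g h k = begin
    ((g ⊞ h) ⊛ f) k          ≈⟨ ⊛-comm (g ⊞ h) f k ⟩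
    (f ⊛ (g ⊞ h)) k          ≈⟨ ⊛-distribˡ-⊞ f g h k ⟩
    (f ⊛ g) k + (f ⊛ h) k    ≈⟨ +-cong (⊛-comm f g k) (⊛-comm f h k) ⟩
    (g ⊛ f) k + (h ⊛ f) k    ∎

  ⊛-scaleˡ : ∀ x f g k → ((λ i → x * f i) ⊛ g) k ≈ x * (f ⊛ g) k
  ⊛-scaleˡ x f g k = trans (sum-cong-≋ {suc k} λ i → *-assoc x (f (toℕ i)) (g (k ℕ.∸ toℕ i)))
    (sym (*-distribˡ-sum {suc k} x λ i → f (toℕ i) * g (k ℕ.∸ toℕ i)))

  -- Induction on the coefficient: dropping the constant term of `f ⊛ g` and shifting leaves `f 0`
  -- times the shift of `g`, plus the shift of `f` times `g`.
  ⊛-assoc : ∀ f g h → (f ⊛ g) ⊛ h ≋ f ⊛ (g ⊛ h)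
  ⊛-assoc f g h zero = begin
    (f 0 * g 0 + 0#) * h 0 + 0#   ≈⟨ +-congʳ (*-congʳ (+-identityʳ _)) ⟩
    f 0 * g 0 * h 0 + 0#          ≈⟨ +-congʳ (*-assoc _ _ _) ⟩
    f 0 * (g 0 * h 0) + 0#        ≈⟨ +-congʳ (*-congˡ (+-identityʳ _)) ⟨
    f 0 * (g 0 * h 0 + 0#) + 0#   ∎
  ⊛-assoc f g h (suc k) = begin
    (f 0 * g 0 + 0#) * h (suc k) + (((λ i → f 0 * g (suc i)) ⊞ (f ∘ suc) ⊛ g) ⊛ h) k
      ≈⟨ +-cong (trans (*-congʳ (+-identityʳ _)) (*-assoc _ _ _))
                (⊛-distribʳ-⊞ h (λ i → f 0 * g (suc i)) ((f ∘ suc) ⊛ g) k) ⟩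
    f 0 * (g 0 * h (suc k)) + (((λ i → f 0 * g (suc i)) ⊛ h) k + (((f ∘ suc) ⊛ g) ⊛ h) k)
      ≈⟨ +-congˡ (+-cong (⊛-scaleˡ (f 0) (g ∘ suc) h k) (⊛-assoc (f ∘ suc) g h k)) ⟩
    f 0 * (g 0 * h (suc k)) + (f 0 * ((g ∘ suc) ⊛ h) k + ((f ∘ suc) ⊛ (g ⊛ h)) k)
      ≈⟨ +-assoc _ _ _ ⟨
    f 0 * (g 0 * h (suc k)) + f 0 * ((g ∘ suc) ⊛ h) k + ((f ∘ suc) ⊛ (g ⊛ h)) k
      ≈⟨ +-congʳ (distribˡ _ _ _) ⟨
    f 0 * (g ⊛ h) (suc k) + ((f ∘ suc) ⊛ (g ⊛ h)) k ∎

  ⊛-identityˡ : ∀ f → one ⊛ f ≋ f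
  ⊛-identityˡ f k = begin
    (one ⊛ f) k                                    ≈⟨ +-congˡ (sum-zero {k} λ i → zeroˡ _) ⟩
    1# * f k + 0#                                  ≈⟨ +-identityʳ _ ⟩
    1# * f k                                       ≈⟨ *-identityˡ _ ⟩
    f k                                            ∎

  seriesRing : CommutativeRing c ℓ
  seriesRing = record
    { Carrier = Series
    ; _≈_ = _≋_
    ; _+_ = _⊞_
    ; _*_ = _⊛_
    ; -_  = λ f k → - f k
    ; 0#  = λ _ → 0#
    ; 1#  = one
    ; isCommutativeRing = record
      { isRing = record
        { +-isAbelianGroup = Pointwise.isAbelianGroup ℕ +-isAbelianGroup
        ; *-cong           = ⊛-cong
        ; *-assoc          = ⊛-assoc
        ; *-identity       = ⊛-identityˡ , λ f k → trans (⊛-comm f one k) (⊛-identityˡ f k)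
        ; distrib          = ⊛-distribˡ-⊞ , ⊛-distribʳ-⊞
        }
      ; *-comm = ⊛-comm
      }
    }

  -- Degrees and constant terms of determinants of power series

  open Determinant seriesRing using (Matrix; altsum; det; minor; _[_]≔_; cramer)
  open Sums (CommutativeRing.+-commutativeMonoid seriesRing) using () renaming (sum to sumₛ)

  sumₛ-coefficient : ∀ {n} (f : Fin n → Series) k → sumₛ f k ≈ sum λ i → f i k
  sumₛ-coefficient {zero}  f k = refl
  sumₛ-coefficient {suc n} f k = +-congˡ (sumₛ-coefficient (tail f) k)

  degree-⊛ : ∀ {d e f g} → Degree≤ d f → Degree≤ e g → Degree≤ (d ℕ.+ e) (f ⊛ g)
  degree-⊛ {d} {e} {f} {g} f-deg g-deg {k} d+e<k = sum-zero {suc k} term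
    where
    term : ∀ i → f (toℕ i) * g (k ℕ.∸ toℕ i) ≈ 0#
    term i with d ℕ.<? toℕ i
    ... | yes d<i = trans (*-congʳ (f-deg d<i)) (zeroˡ _)
    ... | no d≮i  = trans (*-congˡ (g-deg (ℕ.≤-trans
            (ℕ.m+n≤o⇒m≤o∸n (suc e) (ℕ.≤-trans (s≤s (ℕ.≤-reflexive (ℕ.+-comm e d))) d+e<k))
            (ℕ.∸-monoʳ-≤ k (ℕ.≮⇒≥ d≮i))))) (zeroʳ _)

  altsum-vanishes : ∀ {n} (t : Fin n → Series) k → (∀ i → t i k ≈ 0#) → altsum t k ≈ 0#
  altsum-vanishes {zero}  t k t≈0 = refl
  altsum-vanishes {suc n} t k t≈0 =
    trans (+-cong (t≈0 zero) (-‿cong (altsum-vanishes (tail t) k (t≈0 ∘ suc)))) (-‿inverseʳ 0#)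

  det-degree : ∀ {n} (A : Matrix n) → (∀ i j → Degree≤ 1 (A i j)) → Degree≤ n (det A)
  det-degree {zero}  A A-deg {suc k} _   = refl
  det-degree {suc n} A A-deg {k}     n<k = altsum-vanishes (λ j → A j zero ⊛ det (minor A j)) k λ j →
    degree-⊛ (A-deg j zero) (det-degree (minor A j) λ i l → A-deg (punchIn j i) (suc l)) n<k

  -- The constant terms form an identity matrix. Only the diagonal entry of the first column
  -- contributes, and its minor has the same shape.
  det-constant : ∀ {n} (A : Matrix n) →
    (∀ i → A i i 0 ≈ 1#) → (∀ i j → i ≢ j → A i j 0 ≈ 0#) → det A 0 ≈ 1#
  det-constant {zero}  A diagonal off = refl
  det-constant {suc n} A diagonal off = begin
    (A zero zero 0 * det (minor A zero) 0 + 0#) - altsum (λ j → A (suc j) zero ⊛ det (minor A (suc j))) 0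
      ≈⟨ +-cong (trans (+-identityʳ _) (*-cong (diagonal zero)
                  (det-constant (minor A zero) (diagonal ∘ suc)
                    λ i j i≢j → off (suc i) (suc j) (i≢j ∘ Fin.suc-injective))))
                (-‿cong (altsum-vanishes (λ j → A (suc j) zero ⊛ det (minor A (suc j))) 0 λ j →
                  trans (+-identityʳ _) (trans (*-congʳ (off (suc j) zero λ ())) (zeroˡ _)))) ⟩
    1# * 1# - 0#
      ≈⟨ +-cong (*-identityˡ 1#) -0#≈0# ⟩
    1# + 0#
      ≈⟨ +-identityʳ 1# ⟩
    1# ∎

  -- Common denominator of sequences linked by a linear recurrence

  module _ {N : ℕ} (a : Fin N → Series) (M : Fin N → Vector Carrier N)
           (a-rec : ∀ i k → a i (2 ℕ.+ k) ≈ sum λ j → M i j * a j (suc k)) where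

    -- The transpose of I - x M, since Cramer is stated for combinations of rows.
    system : Matrix N
    system j i zero with j Fin.≟ i
    ... | yes _ = 1#
    ... | no  _ = 0#
    system j i (suc zero)    = - M i j
    system j i (suc (suc k)) = 0#

    system-diagonal : ∀ i → system i i 0 ≈ 1#
    system-diagonal i with i Fin.≟ i
    ... | yes _  = refl
    ... | no i≢i = contradiction ≡.refl i≢i

    system-off : ∀ j i → j ≢ i → system j i 0 ≈ 0#
    system-off j i j≢i with j Fin.≟ i
    ... | yes j≡i = contradiction j≡i j≢i
    ... | no  _   = refl

    system-degree : ∀ j i → Degree≤ 1 (system j i)
    system-degree j i {suc (suc k)} _         = refl
    system-degree j i {suc zero}    (s≤s ())

    rhs : Fin N → Series
    rhs i = sumₛ λ j → a j ⊛ system j i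

    open Determinant R using (sum-single)

    -- At index `2 + k` the coefficient is the difference of the two sides of `a-rec`. The
    -- coefficients at 0 and 1 hold the initial values, about which `a-rec` says nothing.
    rhs-degree : ∀ i → Degree≤ 1 (rhs i)
    rhs-degree i {suc zero}    (s≤s ())
    rhs-degree i {suc (suc k)} _ = begin
      rhs i (2 ℕ.+ k)
        ≈⟨ sumₛ-coefficient (λ j → a j ⊛ system j i) (2 ℕ.+ k) ⟩
      sum (λ j → (a j ⊛ system j i) (2 ℕ.+ k))
        ≈⟨ sum-cong-≋ coefficient ⟩
      -- The minus sign is written as a factor `- 1#` so that distributivity can pull it out of the
      -- sum.
      sum (λ j → system j i 0 * a j (2 ℕ.+ k) + - 1# * (M i j * a j (suc k)))
        ≈⟨ ∑-distrib-+ _ (λ j → - 1# * (M i j * a j (suc k))) ⟩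
      sum (λ j → system j i 0 * a j (2 ℕ.+ k)) + sum (λ j → - 1# * (M i j * a j (suc k)))
        ≈⟨ +-cong (sum-single i λ j j≢i → trans (*-congʳ (system-off j i j≢i)) (zeroˡ _))
                  (sym (*-distribˡ-sum (- 1#) λ j → M i j * a j (suc k))) ⟩
      system i i 0 * a i (2 ℕ.+ k) + - 1# * sum (λ j → M i j * a j (suc k))
        ≈⟨ +-cong (trans (*-congʳ (system-diagonal i)) (*-identityˡ _))
                  (trans (-1*x≈-x _) (-‿cong (sym (a-rec i k)))) ⟩
      a i (2 ℕ.+ k) - a i (2 ℕ.+ k)
        ≈⟨ -‿inverseʳ _ ⟩
      0# ∎
      where
      open RingProperties ring using (-1*x≈-x; -‿distribˡ-*)
      coefficient : ∀ j → (a j ⊛ system j i) (2 ℕ.+ k) ≈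
                          system j i 0 * a j (2 ℕ.+ k) + - 1# * (M i j * a j (suc k))
      coefficient j = begin
        (a j ⊛ system j i) (2 ℕ.+ k)
          ≈⟨ ⊛-comm (a j) (system j i) (2 ℕ.+ k) ⟩
        system j i 0 * a j (2 ℕ.+ k) + (- M i j * a j (suc k) + ((λ _ → 0#) ⊛ a j) k)
          ≈⟨ +-congˡ (trans (+-congˡ (sum-zero {suc k} λ l → zeroˡ (a j (k ℕ.∸ toℕ l)))) (+-identityʳ _)) ⟩
        system j i 0 * a j (2 ℕ.+ k) + - M i j * a j (suc k)
          ≈⟨ +-congˡ (trans (sym (-‿distribˡ-* _ _)) (sym (-1*x≈-x _))) ⟩
        system j i 0 * a j (2 ℕ.+ k) + - 1# * (M i j * a j (suc k)) ∎

    -- The row inserted by Cramer's rule is `rhs`, again with entries of degree at most 1, so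
    -- `det-degree` bounds the numerators just as it bounds the denominator.
    commonDenominator : ∃[ D ] Degree≤ N D × D 0 ≈ 1# × ∀ i → HasDenominator (a i) D
    commonDenominator =
      det system , det-degree system system-degree ,
      det-constant system system-diagonal system-off , λ j →
        det (system [ j ]≔ rhs) , (N , det-degree _ (replaced-degree j)) ,
        λ k → trans (⊛-comm (det system) (a j) k) (cramer system a j k)
      where
      replaced-degree : ∀ j i l → Degree≤ 1 ((system [ j ]≔ rhs) i l)
      replaced-degree j i l with i Fin.≟ j
      ... | yes ≡.refl rewrite updateAt-updates j {const rhs} system = rhs-degree l
      ... | no i≢j     rewrite updateAt-minimal i j {const rhs} system i≢j = system-degree i l

  denominator⇒recurrence : ∀ {L D} → Degree≤ L D → D 0 ≈ 1# → ∀ {f} → HasDenominator f D →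
                           SatisfiesEventually {L} (λ i → D (suc (toℕ i))) f
  denominator⇒recurrence {L} {D} D-deg D₀≈1 {f} (P , (d , P-deg) , D⊛f≋P) =
    -- The summand `L` ensures that the product contains all `L` terms of the recurrence and that no
    -- index `k ∸ suc i` is truncated; the summand `suc d` puts `k` beyond the degree of `P`.
    L ℕ.+ suc d , ℕ.m≤m+n L (suc d) , λ k K≤k → begin
      f k + sum {L} (λ i → D (suc (toℕ i)) * f (k ℕ.∸ suc (toℕ i)))
        ≈⟨ +-cong (sym (trans (*-congʳ D₀≈1) (*-identityˡ _)))
             (sym (truncate k (ℕ.m+n≤o⇒m≤o L K≤k) (λ i → D (suc i) * f (k ℕ.∸ suc i))
               λ i L≤i → trans (*-congʳ (D-deg (s≤s L≤i))) (zeroˡ _))) ⟩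
      (D ⊛ f) k
        ≈⟨ D⊛f≋P k ⟩
      P k
        ≈⟨ P-deg (ℕ.m+n≤o⇒n≤o L K≤k) ⟩
      0# ∎
    where
    truncate : ∀ {L} k → L ℕ.≤ k → (t : ℕ → Carrier) → (∀ i → L ℕ.≤ i → t i ≈ 0#) →
               sum {k} (t ∘ toℕ) ≈ sum {L} (t ∘ toℕ)
    truncate k z≤n t t≈0             = sum-zero {k} λ i → t≈0 (toℕ i) z≤n
    truncate (suc k) (s≤s L≤k) t t≈0 =
      +-congˡ (truncate k L≤k (t ∘ suc) λ i L≤i → t≈0 (suc i) (s≤s L≤i))

-- First-step analysis of the game

move-≤ : ∀ {s n} → s ℕ.< n → ∀ r → move s r ℕ.≤ n
move-≤ s<n Sign.+ = s<n
move-≤ s<n Sign.- = ℕ.≤-trans ℕ.pred[n]≤n (ℕ.<⇒≤ s<n)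

module FirstStep {c ℓ : Level} (R : CommutativeRing c ℓ) (p : CommutativeRing.Carrier R) (n : ℕ) where

  open CommutativeRing R hiding (zero)
  open Probability R p
  open PowerSeries R
  open Sums +-commutativeMonoid
  open SemiringSums semiring using (*-distribˡ-sum)
  open CommutativeSemigroupProperties +-commutativeSemigroup using () renaming (interchange to +-interchange)
  open CommutativeSemigroupProperties *-commutativeSemigroup using () renaming (interchange to *-interchange)
  open Determinant R using (sum-single)
  open PowerSeriesRing R
  open SetoidReasoning setoid

  private variable
    a b : Level
    A : Set a
    B : Set b

  total : (A → Carrier) → List A → Carrier
  total f = foldr (λ x y → f x + y) 0#

  total-cong : ∀ {f g : A → Carrier} → (∀ x → f x ≈ g x) → ∀ xs → total f xs ≈ total g xs
  total-cong f≈g []       = refl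
  total-cong f≈g (x ∷ xs) = +-cong (f≈g x) (total-cong f≈g xs)

  total-zero : ∀ {f : A → Carrier} → (∀ x → f x ≈ 0#) → ∀ xs → total f xs ≈ 0#
  total-zero f≈0 []       = refl
  total-zero f≈0 (x ∷ xs) = trans (+-cong (f≈0 x) (total-zero f≈0 xs)) (+-identityˡ 0#)

  total-*ˡ : ∀ x (f : A → Carrier) xs → total (λ y → x * f y) xs ≈ x * total f xs
  total-*ˡ x f []       = sym (zeroʳ x)
  total-*ˡ x f (y ∷ ys) = trans (+-congˡ (total-*ˡ x f ys)) (sym (distribˡ x _ _))

  total-+ : ∀ (f g : A → Carrier) xs → total (λ x → f x + g x) xs ≈ total f xs + total g xs
  total-+ f g []       = sym (+-identityˡ 0#)
  total-+ f g (x ∷ xs) = trans (+-congˡ (total-+ f g xs)) (+-interchange _ _ _ _)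

  total-++ : ∀ (f : A → Carrier) xs ys → total f (xs ++ ys) ≈ total f xs + total f ys
  total-++ f []       ys = sym (+-identityˡ _)
  total-++ f (x ∷ xs) ys = trans (+-congˡ (total-++ f xs ys)) (sym (+-assoc _ _ _))

  total-map : ∀ (f : B → Carrier) (g : A → B) xs →
              total f (map g xs) ≈ total (f ∘ g) xs
  total-map f g []       = refl
  total-map f g (x ∷ xs) = +-congˡ (total-map f g xs)

  total-cartesianProduct : ∀ (f : A × B → Carrier) xs ys →
    total f (cartesianProduct xs ys) ≈ total (λ x → total (λ y → f (x , y)) ys) xs
  total-cartesianProduct f []       ys = refl
  total-cartesianProduct f (x ∷ xs) ys =
    trans (total-++ f (map (x ,_) ys) (cartesianProduct xs ys))
          (+-cong (total-map f (x ,_) ys) (total-cartesianProduct f xs ys))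

  total-filter : ∀ {ℓ′} {P : Pred A ℓ′} (P? : Decidable P) (f : A → Carrier) xs →
    total f (filter P? xs) ≈ total (λ x → if does (P? x) then f x else 0#) xs
  total-filter P? f []       = refl
  total-filter P? f (x ∷ xs) with P? x
  ... | yes _ = +-congˡ (total-filter P? f xs)
  ... | no  _ = trans (total-filter P? f xs) (sym (+-identityˡ _))

  sumSigns : (Sign → Carrier) → Carrier
  sumSigns f = f Sign.+ + f Sign.-

  sumSigns-cong : ∀ {f g} → (∀ r → f r ≈ g r) → sumSigns f ≈ sumSigns g
  sumSigns-cong f≈g = +-cong (f≈g Sign.+) (f≈g Sign.-)

  total-words-suc : ∀ (f : List Sign → Carrier) m →
    total f (words (suc m)) ≈ sumSigns λ r → total (λ u → f (r ∷ u)) (words m)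
  total-words-suc f m = trans (total-++ f (map (Sign.+ ∷_) (words m)) _)
    (+-cong (total-map f _ (words m)) (total-map f _ (words m)))

  -- With an indicator in place of the filter, the sums run over all words and can be split by first
  -- letters.
  outcome : (k s₁ s₂ : ℕ) → List Sign → List Sign → Carrier
  outcome k s₁ s₂ u v =
    if does (firstWins? n k s₁ s₂ (u , v)) then weight u * weight v else 0#

  w≈total : ∀ k s₁ s₂ →
    w n k s₁ s₂ ≈ total (λ u → total (outcome k s₁ s₂ u) (words (k ℕ.∸ 1))) (words k)
  w≈total k s₁ s₂ = trans
    (total-filter (firstWins? n k s₁ s₂) _ (cartesianProduct (words k) (words (k ℕ.∸ 1))))
    (total-cartesianProduct _ (words k) (words (k ℕ.∸ 1)))

  -- Dropping the first letters shifts time by one, and piles agree by computation. Only the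
  -- condition at time 0 is lost, and the two inequalities restore it.
  firstWins-∷ : ∀ k {s₁ s₂} → s₁ ≢ n → s₂ ≢ n → ∀ r₁ u r₂ v →
    FirstWins n (suc k) s₁ s₂ (r₁ ∷ u , r₂ ∷ v) ⇔
    FirstWins n k (move s₁ r₁) (move s₂ r₂) (u , v)
  firstWins-∷ k s₁≢n s₂≢n r₁ u r₂ v = mk⇔
    (λ (hits , before) → hits , λ i<k → before (s<s i<k))
    (λ (hits , before) → hits , λ
      { {zero}  _         → s₁≢n , s₂≢n
      ; {suc i} (s<s i<k) → before i<k })

  outcome-∷ : ∀ k {s₁ s₂} → s₁ ≢ n → s₂ ≢ n → ∀ r₁ u r₂ v →
    outcome (suc k) s₁ s₂ (r₁ ∷ u) (r₂ ∷ v) ≈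
    chance r₁ * chance r₂ * outcome k (move s₁ r₁) (move s₂ r₂) u v
  outcome-∷ k {s₁} {s₂} s₁≢n s₂≢n r₁ u r₂ v
    rewrite does-⇔ (firstWins-∷ k s₁≢n s₂≢n r₁ u r₂ v)
              (firstWins? n (suc k) s₁ s₂ (r₁ ∷ u , r₂ ∷ v))
              (firstWins? n k (move s₁ r₁) (move s₂ r₂) (u , v))
    with does (firstWins? n k (move s₁ r₁) (move s₂ r₂) (u , v))
  ... | true  = *-interchange _ _ _ _
  ... | false = sym (zeroʳ _)

  -- At turn `2 + k` the opponent's word has length `suc k`, so both words have a first letter; what
  -- remains has exactly the lengths that belong to turn `suc k`.
  w-step : ∀ k {s₁ s₂} → s₁ ≢ n → s₂ ≢ n →
    w n (2 ℕ.+ k) s₁ s₂ ≈ sumSigns λ r₁ → sumSigns λ r₂ →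
      chance r₁ * chance r₂ * w n (suc k) (move s₁ r₁) (move s₂ r₂)
  w-step k {s₁} {s₂} s₁≢n s₂≢n = begin
    w n (2 ℕ.+ k) s₁ s₂
      ≈⟨ w≈total (2 ℕ.+ k) s₁ s₂ ⟩
    total (λ u → total (outcome (2 ℕ.+ k) s₁ s₂ u) (words (suc k))) (words (2 ℕ.+ k))
      ≈⟨ total-words-suc (λ u → total (outcome (2 ℕ.+ k) s₁ s₂ u) (words (suc k))) (suc k) ⟩
    sumSigns (λ r₁ → total (λ u → total (outcome (2 ℕ.+ k) s₁ s₂ (r₁ ∷ u)) (words (suc k))) (words (suc k)))
      ≈⟨ sumSigns-cong (λ r₁ → total-cong (λ u → total-words-suc (outcome (2 ℕ.+ k) s₁ s₂ (r₁ ∷ u)) k) (words (suc k))) ⟩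
    sumSigns (λ r₁ → total (λ u → sumSigns λ r₂ →
      total (λ v → outcome (2 ℕ.+ k) s₁ s₂ (r₁ ∷ u) (r₂ ∷ v)) (words k)) (words (suc k)))
      -- The sum over the opponent's first letter is moved outside the sum over the rest of the
      -- first player's word.
      ≈⟨ sumSigns-cong (λ r₁ → total-+
           (λ u → total (λ v → outcome (2 ℕ.+ k) s₁ s₂ (r₁ ∷ u) (Sign.+ ∷ v)) (words k))
           (λ u → total (λ v → outcome (2 ℕ.+ k) s₁ s₂ (r₁ ∷ u) (Sign.- ∷ v)) (words k))
           (words (suc k))) ⟩
    sumSigns (λ r₁ → sumSigns λ r₂ → total (λ u →
      total (λ v → outcome (2 ℕ.+ k) s₁ s₂ (r₁ ∷ u) (r₂ ∷ v)) (words k)) (words (suc k)))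
      ≈⟨ sumSigns-cong (λ r₁ → sumSigns-cong (factor r₁)) ⟩
    sumSigns (λ r₁ → sumSigns λ r₂ →
      chance r₁ * chance r₂ * w n (suc k) (move s₁ r₁) (move s₂ r₂)) ∎
    where
    factor : ∀ r₁ r₂ →
      total (λ u → total (λ v → outcome (2 ℕ.+ k) s₁ s₂ (r₁ ∷ u) (r₂ ∷ v)) (words k)) (words (suc k)) ≈
      chance r₁ * chance r₂ * w n (suc k) (move s₁ r₁) (move s₂ r₂)
    factor r₁ r₂ = begin
      total (λ u → total (λ v → outcome (2 ℕ.+ k) s₁ s₂ (r₁ ∷ u) (r₂ ∷ v)) (words k)) (words (suc k))
        ≈⟨ total-cong (λ u → trans
             (total-cong (outcome-∷ (suc k) s₁≢n s₂≢n r₁ u r₂) (words k))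
             (total-*ˡ (chance r₁ * chance r₂) (outcome (suc k) (move s₁ r₁) (move s₂ r₂) u) (words k)))
             (words (suc k)) ⟩
      total (λ u → chance r₁ * chance r₂ *
                   total (outcome (suc k) (move s₁ r₁) (move s₂ r₂) u) (words k)) (words (suc k))
        ≈⟨ total-*ˡ (chance r₁ * chance r₂) _ (words (suc k)) ⟩
      chance r₁ * chance r₂ *
        total (λ u → total (outcome (suc k) (move s₁ r₁) (move s₂ r₂) u) (words k)) (words (suc k))
        ≈⟨ *-congˡ (w≈total (suc k) (move s₁ r₁) (move s₂ r₂)) ⟨
      chance r₁ * chance r₂ * w n (suc k) (move s₁ r₁) (move s₂ r₂) ∎

  w-impossible : ∀ k {s₁ s₂} → (∀ uv → ¬ FirstWins n k s₁ s₂ uv) → w n k s₁ s₂ ≈ 0#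
  w-impossible k {s₁} {s₂} ¬wins = trans (w≈total k s₁ s₂)
    (total-zero (λ u → total-zero (λ v → reflexive
      (≡.cong (if_then weight u * weight v else 0#)
              (dec-false (firstWins? n k s₁ s₂ (u , v)) (¬wins (u , v)))))
      (words (k ℕ.∸ 1))) (words k))

  -- At a positive turn, time 0 counts as an earlier time, and a pile of `n` chips there rules out a
  -- later win. At turn 0 the value would be 1.
  w-boundary₁ : ∀ k s₂ → w n (suc k) n s₂ ≈ 0#
  w-boundary₁ k s₂ = w-impossible (suc k) λ uv (_ , before) → proj₁ (before (s≤s z≤n)) ≡.refl

  w-boundary₂ : ∀ k s₁ → w n (suc k) s₁ n ≈ 0#
  w-boundary₂ k s₁ = w-impossible (suc k) λ uv (_ , before) → proj₂ (before (s≤s z≤n)) ≡.refl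

  -- Interior states and the recurrence between their series

  pile₁ pile₂ : Fin (n ℕ.* n) → ℕ
  pile₁ i = toℕ (Fin.quotient {n} n i)
  pile₂ i = toℕ (Fin.remainder {n} n i)

  interiorW : Fin (n ℕ.* n) → Series
  interiorW i = W n (pile₁ i) (pile₂ i)

  -- Linear combinations, with coefficients independent of k, of the n² sequences
  -- k ↦ w n (suc k) s₁ s₂ with s₁, s₂ < n.
  IsCombination : (ℕ → Carrier) → Set _
  IsCombination y =
    Σ[ r ∈ Vector Carrier (n ℕ.* n) ] ∀ k → y k ≈ sum λ i → r i * interiorW i (suc k)

  combination-zero : ∀ {y} → (∀ k → y k ≈ 0#) → IsCombination y
  combination-zero y≈0 = (λ _ → 0#) , λ k →
    trans (y≈0 k) (sym (sum-zero λ i → zeroˡ (interiorW i (suc k))))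

  combination-+ : ∀ {y z} → IsCombination y → IsCombination z → IsCombination (λ k → y k + z k)
  combination-+ (r , y≈) (s , z≈) = (λ i → r i + s i) , λ k →
    trans (+-cong (y≈ k) (z≈ k))
          (trans (sym (∑-distrib-+ (λ i → r i * interiorW i (suc k)) (λ i → s i * interiorW i (suc k))))
                 (sum-cong-≋ λ i → sym (distribʳ (interiorW i (suc k)) (r i) (s i))))

  combination-* : ∀ x {y} → IsCombination y → IsCombination (λ k → x * y k)
  combination-* x (r , y≈) = (λ i → x * r i) , λ k →
    trans (*-congˡ (y≈ k))
          (trans (*-distribˡ-sum x (λ i → r i * interiorW i (suc k)))
                 (sum-cong-≋ λ i → sym (*-assoc x (r i) (interiorW i (suc k)))))

  combination-sumSigns : ∀ {y : Sign → ℕ → Carrier} → (∀ r → IsCombination (y r)) →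
                         IsCombination (λ k → sumSigns λ r → y r k)
  combination-sumSigns y-comb = combination-+ (y-comb Sign.+) (y-comb Sign.-)

  combination-self : ∀ i → IsCombination (λ k → interiorW i (suc k))
  combination-self i = unit , λ k → sym (trans (sum-single i (off k)) (on k))
    where
    unit : Fin (n ℕ.* n) → Carrier
    unit j = if does (j Fin.≟ i) then 1# else 0#
    off : ∀ k j → j ≢ i → unit j * interiorW j (suc k) ≈ 0#
    off k j j≢i with j Fin.≟ i
    ... | yes j≡i = contradiction j≡i j≢i
    ... | no  _   = zeroˡ _
    on : ∀ k → unit i * interiorW i (suc k) ≈ interiorW i (suc k)
    on k with i Fin.≟ i
    ... | yes _  = *-identityˡ _
    ... | no i≢i = contradiction ≡.refl i≢i

  interior : ∀ {ℓ} (P : ℕ → ℕ → Set ℓ) → (∀ i → P (pile₁ i) (pile₂ i)) →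
             ∀ {s₁ s₂} → s₁ ℕ.< n → s₂ ℕ.< n → P s₁ s₂
  interior P Pᵢ s₁<n s₂<n = ≡.subst₂ P
    (≡.trans (≡.cong (toℕ ∘ proj₁) (Fin.remQuot-combine (Fin.fromℕ< s₁<n) (Fin.fromℕ< s₂<n))) (Fin.toℕ-fromℕ< s₁<n))
    (≡.trans (≡.cong (toℕ ∘ proj₂) (Fin.remQuot-combine (Fin.fromℕ< s₁<n) (Fin.fromℕ< s₂<n))) (Fin.toℕ-fromℕ< s₂<n))
    (Pᵢ (Fin.combine (Fin.fromℕ< s₁<n) (Fin.fromℕ< s₂<n)))

  combination-w : ∀ {s₁ s₂} → s₁ ℕ.≤ n → s₂ ℕ.≤ n → IsCombination (λ k → w n (suc k) s₁ s₂)
  combination-w {s₁} {s₂} s₁≤n s₂≤n with ℕ.m≤n⇒m<n∨m≡n s₁≤n | ℕ.m≤n⇒m<n∨m≡n s₂≤n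
  ... | inj₂ ≡.refl | _           = combination-zero λ k → w-boundary₁ k s₂
  ... | inj₁ _      | inj₂ ≡.refl = combination-zero λ k → w-boundary₂ k s₁
  ... | inj₁ s₁<n   | inj₁ s₂<n   =
    interior (λ t₁ t₂ → IsCombination (λ k → w n (suc k) t₁ t₂)) combination-self s₁<n s₂<n

  -- The coefficients found here are row `i` of the transition matrix. It is never written out:
  -- closure of combinations under sums and scaling assembles it, and moves that reach `n` chips
  -- contribute the zero combination.
  combination-next : ∀ i → IsCombination (λ k → interiorW i (2 ℕ.+ k))
  combination-next i =
    let r , sum≈ = combination-sumSigns λ r₁ → combination-sumSigns λ r₂ →
                     combination-* (chance r₁ * chance r₂)
                       (combination-w (move-≤ pile₁<n r₁) (move-≤ pile₂<n r₂))
    in r , λ k → trans (w-step k (ℕ.<⇒≢ pile₁<n) (ℕ.<⇒≢ pile₂<n)) (sum≈ k)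
    where
    pile₁<n : pile₁ i ℕ.< n
    pile₁<n = Fin.toℕ<n (Fin.quotient {n} n i)
    pile₂<n : pile₂ i ℕ.< n
    pile₂<n = Fin.toℕ<n (Fin.remainder {n} n i)

  -- Such a series reduces to its constant term, so multiplying it by any polynomial gives a
  -- polynomial.
  boundary⇒denominator : ∀ {L D s₁ s₂} → (∀ k → w n (suc k) s₁ s₂ ≈ 0#) → Degree≤ L D →
                         HasDenominator (W n s₁ s₂) D
  boundary⇒denominator {L} {D} {s₁} {s₂} w≈0 D-deg =
    D ⊛ W n s₁ s₂ ,
    (L ℕ.+ 0 , degree-⊛ {g = W n s₁ s₂} D-deg λ { {suc k} _ → w≈0 k }) ,
    λ k → refl

  extend-denominator : ∀ {L D} → Degree≤ L D → (∀ i → HasDenominator (interiorW i) D) →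
    ∀ s₁ s₂ → s₁ ℕ.≤ n → s₂ ℕ.≤ n → HasDenominator (W n s₁ s₂) D
  extend-denominator {D = D} D-deg D-interior s₁ s₂ s₁≤n s₂≤n
    with ℕ.m≤n⇒m<n∨m≡n s₁≤n | ℕ.m≤n⇒m<n∨m≡n s₂≤n
  ... | inj₂ ≡.refl | _           = boundary⇒denominator (λ k → w-boundary₁ k s₂) D-deg
  ... | inj₁ _      | inj₂ ≡.refl = boundary⇒denominator (λ k → w-boundary₂ k s₁) D-deg
  ... | inj₁ s₁<n   | inj₁ s₂<n   =
    interior (λ t₁ t₂ → HasDenominator (W n t₁ t₂) D) D-interior s₁<n s₂<n

  denominator : ∃[ D ] Degree≤ (n ℕ.* n) D × D 0 ≈ 1# ×
                (∀ s₁ s₂ → s₁ ℕ.≤ n → s₂ ℕ.≤ n → HasDenominator (W n s₁ s₂) D)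
  denominator =
    let D , D-deg , D₀≈1 , D-interior = commonDenominator interiorW
          (λ i → proj₁ (combination-next i)) (λ i → proj₂ (combination-next i))
    in D , D-deg , D₀≈1 , extend-denominator D-deg D-interior

theorem9 : {c ℓ₁ ℓ₂ ℓ₃ : Level} (F : OrderedField c ℓ₁ ℓ₂ ℓ₃) →
    let open OrderedField F
        open PowerSeries commutativeRing
    in
    (p : Carrier) → 0# ≤ p → p ≤ 1# →
    let open Probability commutativeRing p in
    (n : ℕ) → 1 ℕ.≤ n →
    let L = n ℕ.* (n ℕ.+ 1) in
    (∃[ D ] Degree≤ L D × D 0 # 0# ×
      (∀ s₁ s₂ → s₁ ℕ.≤ n → s₂ ℕ.≤ n → HasDenominator (W n s₁ s₂) D))
    ×
    (∃[ c ] (∀ s₁ s₂ → s₁ ℕ.≤ n → s₂ ℕ.≤ n →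
      SatisfiesEventually {L} c (λ k → w n k s₁ s₂)))
theorem9 F p _ _ n _ =
  let D , D-deg , D₀≈1 , D-den = denominator
      -- The determinant has size `n * n`, and `n * n ≤ n * (n + 1)` gives the stated degree.
      D-deg′ = λ {k} L<k → D-deg {k} (ℕ.≤-<-trans (ℕ.*-monoʳ-≤ n (ℕ.m≤m+n n 1)) L<k)
  in (D , D-deg′ , ≈1⇒#0 D₀≈1 , D-den) ,
     ((λ i → D (suc (toℕ i))) , λ s₁ s₂ s₁≤n s₂≤n →
       denominator⇒recurrence D-deg′ D₀≈1 (D-den s₁ s₂ s₁≤n s₂≤n))
  where
  open OrderedField F
  open FirstStep commutativeRing p n using (denominator)
  open PowerSeriesRing commutativeRing using (denominator⇒recurrence)
  open RingProperties (CommutativeRing.ring commutativeRing) using (-0#≈0#)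
  -- In a Heyting field apartness follows from an invertible difference; here `x - 0#` equals 1 and
  -- has the inverse 1.
  ≈1⇒#0 : ∀ {x} → x ≈ 1# → x # 0#
  ≈1⇒#0 {x} x≈1 = invertible⇒# (1# , trans (*-identityˡ _) x-0≈1 , trans (*-identityʳ _) x-0≈1)
    where
    x-0≈1 : x - 0# ≈ 1#
    x-0≈1 = trans (+-cong x≈1 -0#≈0#) (+-identityʳ 1#)
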